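{- Let $G$ be a crown-free linear $3$-graph on $n$ vertices, and let $s$ be the number of vertices of $G$ of degree at least $6$. Then the number of edges of $G$ satisfies $$|E(G)| \leq \frac{3(n-s)}{2}.$$
   Context: A linear $3$-graph $G=(V,E)$ consists of a finite vertex set $V$ and a collection $E$ of $3$-element subsets of $V$ (edges) such that any two distinct edges share at most one vertex. The degree $d(v)$ of a vertex $v$ is the number of edges containing $v$. The crown $C_{13}$ is the linear $3$-graph on $9$ vertices $\{a,b,c,d,e,f,g,h,i\}$ with edges $\{a,b,c\},\{a,d,e\},\{b,f,g\},\{c,h,i\}$. A linear $3$-graph is crown-free if it contains no copy of $C_{13}$, i.e. no four of its edges together with an injective assignment of the nine vertices form the crown. -}

module Defs where

open import Data.Bool.Properties as Bool using ()
open import Data.Fin using (Fin; #_)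
open import Data.Fin.Subset using (Subset; _∈_; _∩_; _∪_; ⋃; ⁅_⁆; ∣_∣)
open import Data.Fin.Subset.Properties using (_∈?_)
open import Data.List using (List; []; _∷_; length; filter; map; allFin)
open import Data.List.Membership.Propositional using () renaming (_∈_ to _∈ˡ_)
open import Data.List.Relation.Unary.All using (All; all?; lookup)
open import Data.List.Relation.Unary.AllPairs using (allPairs?)
open import Data.List.Relation.Unary.Unique.Propositional using (Unique)
open import Data.Nat using (ℕ; _≤_; _≤?_; _≟_)
open import Data.Product using (∃-syntax; _×_)
open import Data.Vec.Properties using (≡-dec)
open import Function using (_∘_)
open import Function.Definitions using (Injective)
open import Relation.Binary.Definitions using (DecidableEquality)
open import Relation.Binary.PropositionalEquality using (_≡_; _≢_)
open import Relation.Nullary using (¬_)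
open import Relation.Nullary.Decidable using (¬?; _→-dec_; from-yes)

-- The vertex set is Fin n.  The edge set is a duplicate-free enumeration, so
-- that its cardinality is the length of the list.
record Linear3Graph (n : ℕ) : Set where
  field
    edges   : List (Subset n)
    unique  : Unique edges
    uniform : All (λ e → ∣ e ∣ ≡ 3) edges
    linear  : ∀ {e f} → e ∈ˡ edges → f ∈ˡ edges → e ≢ f → ∣ e ∩ f ∣ ≤ 1

  size : ℕ
  size = length edges

  degree : Fin n → ℕ
  degree v = length (filter (v ∈?_) edges)

  #degree≥ : ℕ → ℕ
  #degree≥ k = length (filter (λ v → k ≤? degree v) (allFin n))

open Linear3Graph public

image : ∀ {m n} → (Fin m → Fin n) → Subset m → Subset n
image φ e = ⋃ (map (⁅_⁆ ∘ φ) (filter (_∈? e) (allFin _)))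

-- G contains a (not necessarily induced) copy of H.
ContainsCopy : ∀ {m n} → Linear3Graph m → Linear3Graph n → Set
ContainsCopy {m} {n} H G =
  ∃[ φ ] Injective {A = Fin m} {B = Fin n} _≡_ _≡_ φ
       × (∀ {e} → e ∈ˡ edges H → image φ e ∈ˡ edges G)

crownEdges : List (Subset 9)
crownEdges =
  triple a b c ∷ triple a d e ∷ triple b f g ∷ triple c h i ∷ []
  where
  triple : Fin 9 → Fin 9 → Fin 9 → Subset 9
  triple x y z = ⁅ x ⁆ ∪ ⁅ y ⁆ ∪ ⁅ z ⁆

  a b c d e f g h i : Fin 9
  a = # 0
  b = # 1
  c = # 2
  d = # 3
  e = # 4
  f = # 5
  g = # 6
  h = # 7
  i = # 8

C₁₃ : Linear3Graph 9
C₁₃ = record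
  { edges   = crownEdges
  ; unique  = from-yes (allPairs? (λ e f → ¬? (e ≟ˢ f)) crownEdges)
  ; uniform = from-yes (all? (λ e → ∣ e ∣ ≟ 3) crownEdges)
  ; linear  = λ e∈ f∈ → lookup (lookup linear-dec e∈) f∈
  }
  where
  _≟ˢ_ : DecidableEquality (Subset 9)
  _≟ˢ_ = ≡-dec Bool._≟_

  linear-dec : All (λ e → All (λ f → e ≢ f → ∣ e ∩ f ∣ ≤ 1) crownEdges) crownEdges
  linear-dec = from-yes (all? (λ e → all? (λ f →
    ¬? (e ≟ˢ f) →-dec (∣ e ∩ f ∣ ≤? 1)) crownEdges) crownEdges)

CrownFree : ∀ {n} → Linear3Graph n → Set
CrownFree G = ¬ ContainsCopy C₁₃ G

{-# OPTIONS --safe #-}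

-- Discharging: an edge asks for 1 in total from its vertices, a vertex of degree
-- at most 5 can give 3/2, and a vertex of degree at least 6 gives nothing.  If
-- every vertex v of degree d ≤ 5 splits 3/2 (roughly) evenly among its d edges,
-- crown-freeness implies that the only underfed ("heavy") edges abc have degrees
-- (5,5,5) or (5,5,4): an edge of degrees at least (6,4,2) extends greedily to a
-- crown.  Around a heavy edge abc, the pairs completing a, b and c to the other
-- edges are three matchings without a disjoint rainbow triple.  This forces them
-- to be the three perfect matchings of two disjoint K₄'s, with at most one pair
-- of the c-matching missing, and no further edge meets these eight vertices.  So
-- every neighbour of a, b, c outside abc has degree at most 3 and pays 1/2 per
-- edge: two such neighbours satisfy an edge on their own, and a, b, c are free to
-- pay for abc.

module Submission where

open import Defs
open import Data.Bool using (true; false; if_then_else_)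
import Data.Bool.Properties as Bool
open import Data.Empty using (⊥; ⊥-elim)
open import Data.Fin using (Fin; suc; _≟_; _↑ʳ_)
open import Data.Fin.Patterns
open import Data.Fin.Properties using (all?)
open import Data.Fin.Subset using (Subset; _∈_; _∉_; _∪_; ⁅_⁆; ∣_∣) renaming (⊥ to ∅)
open import Data.Fin.Subset.Properties
  using (_∈?_; ∉⊥; x∈⁅x⁆; x∈⁅y⁆⇒x≡y; x∈p∩q⁺; x∈p∪q⁺; x∈p∪q⁻; x∈p⇒∣p-x∣<∣p∣;
         x∈p∧x≢y⇒x∈p-y; ⊆-antisym; drop-there)
import Data.Integer as ℤ
import Data.Integer.Properties as ℤ
open import Data.List using (List; []; _∷_; length; filter; map; allFin; tabulate)
open import Data.List.Membership.Propositional using (lose; find) renaming (_∈_ to _∈ˡ_)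
open import Data.List.Membership.Propositional.Properties using (∈-filter⁻; ∈-tabulate⁺)
open import Data.List.Properties
  using (filter-all; filter-≐; map-tabulate; map-cong; length-tabulate)
open import Data.List.Relation.Unary.All as All using (All; []; _∷_)
open import Data.List.Relation.Unary.All.Properties using (all-filter)
open import Data.List.Relation.Unary.AllPairs using ([]; _∷_)
open import Data.List.Relation.Unary.Any using (Any; here; there; any?)
open import Data.List.Relation.Unary.Unique.Propositional using (Unique)
open import Data.List.Relation.Unary.Unique.Propositional.Properties using (allFin⁺; filter⁺)
import Data.Nat as ℕ
open import Data.Nat using (ℕ; suc; _+_; _<_; z≤n; s≤s; s≤s⁻¹; _≤?_)
open import Data.Nat.ListAction using (sum)
import Data.Nat.Properties as ℕ
open import Data.Product using (∃-syntax; _×_; _,_; proj₁; proj₂)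
open import Data.Sum using (_⊎_; inj₁; inj₂; [_,_]′)
open import Data.Vec as Vec using (Vec; []; _∷_; there)
open import Data.Vec.Properties using (≡-dec)
open import Data.Vec.Relation.Unary.All as VecAll using ([]; _∷_)
import Data.Vec.Relation.Unary.All.Properties as VecAll
open import Data.Vec.Relation.Unary.AllPairs using ([]; _∷_)
import Data.Vec.Relation.Unary.AllPairs.Properties as VecAllPairs
import Data.Vec.Relation.Unary.Unique.Propositional as VecUnique
import Data.Vec.Relation.Unary.Unique.Propositional.Properties as VecUnique
open import Function using (_∘_; id)
open import Function.Definitions using (Injective)
open import Relation.Binary.PropositionalEquality
open import Relation.Nullary using (¬_; Dec; yes; no; does; contradiction)
open import Relation.Nullary.Decidable
  using (False; toWitnessFalse; from-yes; dec-true; dec-false; ¬?; _×-dec_)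
open import Relation.Unary using (Decidable)

-- Finite counting, double sums and the charge function.

module Counting where

  open import Data.Nat using (_≤_; _*_; _≤′_; ≤′-reflexive; ≤′-step)
  open import Algebra.Properties.CommutativeSemigroup ℕ.+-commutativeSemigroup using (interchange)

  private variable
    A B : Set

  length-filter-map : ∀ {P : B → Set} (P? : Decidable P) (f : A → B) xs →
    length (filter P? (map f xs)) ≡ length (filter (P? ∘ f) xs)
  length-filter-map P? f []       = refl
  length-filter-map P? f (x ∷ xs) with does (P? (f x))
  ... | true  = cong suc (length-filter-map P? f xs)
  ... | false = length-filter-map P? f xs

  length-discard-≤1 : ∀ {P : A → Set} (P? : Decidable P) {xs} → Unique xs →
    (∀ {x y} → x ∈ˡ xs → y ∈ˡ xs → P x → P y → x ≡ y) →
    length xs ≤ suc (length (filter (¬? ∘ P?) xs))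
  length-discard-≤1 P? {[]} _ _ = z≤n
  length-discard-≤1 P? {x ∷ xs} (x∉ ∷ xs!) one with P? x
  ... | yes Px rewrite filter-all (¬? ∘ P?) {xs}
          (All.tabulate λ y∈ Py → All.lookup x∉ y∈ (one (here refl) (there y∈) Px Py)) = ℕ.≤-refl
  ... | no _ = s≤s (length-discard-≤1 P? xs! λ x∈ y∈ → one (there x∈) (there y∈))

  members : ∀ {n} → Subset n → List (Fin n)
  members e = filter (_∈? e) (allFin _)

  length-members : ∀ {n} (e : Subset n) → length (members e) ≡ ∣ e ∣
  length-members []              = refl
  length-members {suc n} (b ∷ e) = step b
    where
    tail : ∀ b → length (filter (_∈? (b ∷ e)) (tabulate suc)) ≡ ∣ e ∣
    tail b = begin
      length (filter (_∈? (b ∷ e)) (tabulate suc))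
        ≡⟨ cong (length ∘ filter (_∈? (b ∷ e))) (map-tabulate id suc) ⟨
      length (filter (_∈? (b ∷ e)) (map suc (allFin n)))
        ≡⟨ length-filter-map (_∈? (b ∷ e)) suc (allFin n) ⟩
      length (filter ((_∈? (b ∷ e)) ∘ suc) (allFin n))
        ≡⟨ cong length (filter-≐ ((_∈? (b ∷ e)) ∘ suc) (_∈? e) (drop-there , there) (allFin n)) ⟩
      length (members e)
        ≡⟨ length-members e ⟩
      ∣ e ∣ ∎
      where open ≡-Reasoning
    step : ∀ b → length (members (b ∷ e)) ≡ ∣ b ∷ e ∣
    step true  = cong suc (tail true)
    step false = tail false

  length≤∣∣ : ∀ {n} {e : Subset n} {xs} → Unique xs → All (_∈ e) xs → length xs ≤ ∣ e ∣
  length≤∣∣ []         []          = z≤n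
  length≤∣∣ (x∉ ∷ xs!) (x∈ ∷ xs∈) =
    ℕ.≤-<-trans (length≤∣∣ xs! (All.zipWith (λ (y∈ , x≢y) → x∈p∧x≢y⇒x∈p-y y∈ (x≢y ∘ sym)) (xs∈ , x∉)))
      (x∈p⇒∣p-x∣<∣p∣ x∈)

  sum-map-+ : ∀ (f g : A → ℕ) xs → sum (map (λ x → f x + g x) xs) ≡ sum (map f xs) + sum (map g xs)
  sum-map-+ f g []       = refl
  sum-map-+ f g (x ∷ xs) =
    trans (cong (f x + g x +_) (sum-map-+ f g xs)) (interchange (f x) (g x) _ _)

  sum-map-0 : ∀ (xs : List A) → sum (map (λ _ → 0) xs) ≡ 0
  sum-map-0 []       = refl
  sum-map-0 (_ ∷ xs) = sum-map-0 xs

  sum-swap : ∀ (h : A → B → ℕ) xs ys →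
    sum (map (λ x → sum (map (h x) ys)) xs) ≡ sum (map (λ y → sum (map (λ x → h x y) xs)) ys)
  sum-swap h []       ys = sym (sum-map-0 ys)
  sum-swap h (x ∷ xs) ys =
    trans (cong (sum (map (h x) ys) +_) (sum-swap h xs ys)) (sym (sum-map-+ (h x) _ ys))

  sum-filter : ∀ {P : A → Set} (P? : Decidable P) (f : A → ℕ) xs →
    sum (map f (filter P? xs)) ≡ sum (map (λ x → if does (P? x) then f x else 0) xs)
  sum-filter P? f []       = refl
  sum-filter P? f (x ∷ xs) with does (P? x)
  ... | true  = cong (f x +_) (sum-filter P? f xs)
  ... | false = sum-filter P? f xs

  -- Replacing each filter by zero summands turns both sides into full double sums, whose order can
  -- be exchanged.
  double-count : ∀ {R : A → B → Set} (R? : ∀ x y → Dec (R x y)) (f : A → B → ℕ) xs ys →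
    sum (map (λ y → sum (map (λ x → f x y) (filter (λ x → R? x y) xs))) ys) ≡
    sum (map (λ x → sum (map (f x) (filter (R? x) ys))) xs)
  double-count R? f xs ys = begin
    sum (map (λ y → sum (map (λ x → f x y) (filter (λ x → R? x y) xs))) ys)
      ≡⟨ cong sum (map-cong (λ y → sum-filter (λ x → R? x y) (λ x → f x y) xs) ys) ⟩
    sum (map (λ y → sum (map (λ x → if does (R? x y) then f x y else 0) xs)) ys)
      ≡⟨ sum-swap (λ y x → if does (R? x y) then f x y else 0) ys xs ⟩
    sum (map (λ x → sum (map (λ y → if does (R? x y) then f x y else 0) ys)) xs)
      ≡⟨ cong sum (map-cong (λ x → sum-filter (R? x) (f x) ys) xs) ⟨
    sum (map (λ x → sum (map (f x) (filter (R? x) ys))) xs) ∎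
    where open ≡-Reasoning

  sum-upper : ∀ (f : A → ℕ) {k xs} → (∀ {x} → x ∈ˡ xs → f x ≤ k) → sum (map f xs) ≤ length xs * k
  sum-upper f {xs = []}    _  = z≤n
  sum-upper f {xs = _ ∷ _} f≤ = ℕ.+-mono-≤ (f≤ (here refl)) (sum-upper f (f≤ ∘ there))

  sum-lower : ∀ (f : A → ℕ) {k xs} → (∀ {x} → x ∈ˡ xs → k ≤ f x) → length xs * k ≤ sum (map f xs)
  sum-lower f {xs = []}    _  = z≤n
  sum-lower f {xs = _ ∷ _} ≤f = ℕ.+-mono-≤ (≤f (here refl)) (sum-lower f (≤f ∘ there))

  sum-support-≤1 : ∀ {P : A → Set} (P? : Decidable P) (f : A → ℕ) {k xs} → Unique xs →
    (∀ {x y} → x ∈ˡ xs → y ∈ˡ xs → P x → P y → x ≡ y) →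
    (∀ {x} → x ∈ˡ xs → f x ≤ k) → (∀ {x} → x ∈ˡ xs → ¬ P x → f x ≤ 0) → sum (map f xs) ≤ k
  sum-support-≤1 P? f {xs = []} _ _ _ _ = z≤n
  sum-support-≤1 P? f {k} {x ∷ xs} (x∉ ∷ xs!) one f≤k f≤0 with P? x
  ... | no ¬Px = ℕ.+-mono-≤ (f≤0 (here refl) ¬Px)
        (sum-support-≤1 P? f xs! (λ x∈ y∈ → one (there x∈) (there y∈)) (f≤k ∘ there) (f≤0 ∘ there))
  ... | yes Px = begin
    f x + sum (map f xs) ≤⟨ ℕ.+-mono-≤ (f≤k (here refl)) (sum-upper f λ y∈ → f≤0 (there y∈) λ Py →
                              All.lookup x∉ y∈ (one (here refl) (there y∈) Px Py)) ⟩
    k + length xs * 0    ≡⟨ cong (k +_) (ℕ.*-zeroʳ (length xs)) ⟩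
    k + 0                ≡⟨ ℕ.+-identityʳ k ⟩
    k                    ∎
    where open ℕ.≤-Reasoning

  -- Elements of `P` contribute nothing; their part of the bound stands on the left to avoid
  -- truncated subtraction.
  sum-upper-filter : ∀ {P : A → Set} (P? : Decidable P) (f : A → ℕ) {k} xs → (∀ x → f x ≤ k) →
    (∀ {x} → P x → f x ≤ 0) → sum (map f xs) + length (filter P? xs) * k ≤ length xs * k
  sum-upper-filter P? f []       _   _   = z≤n
  sum-upper-filter P? f {k} (x ∷ xs) f≤k f≤0 with P? x
  ... | yes Px = begin
    f x + sum (map f xs) + (k + length (filter P? xs) * k)   ≡⟨ interchange (f x) _ k _ ⟩
    (f x + k) + (sum (map f xs) + length (filter P? xs) * k) ≤⟨ ℕ.+-mono-≤ (ℕ.+-monoˡ-≤ k (f≤0 Px)) (sum-upper-filter P? f xs f≤k f≤0) ⟩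
    k + length xs * k ∎
    where open ℕ.≤-Reasoning
  ... | no _ = begin
    f x + sum (map f xs) + length (filter P? xs) * k   ≡⟨ ℕ.+-assoc (f x) _ _ ⟩
    f x + (sum (map f xs) + length (filter P? xs) * k) ≤⟨ ℕ.+-mono-≤ (f≤k x) (sum-upper-filter P? f xs f≤k f≤0) ⟩
    k + length xs * k ∎
    where open ℕ.≤-Reasoning

  -- What a vertex of degree d gives to each of its edges, in units of 1/20: an edge
  -- needs 20 and a vertex owns 30.
  share : ℕ → ℕ
  share 0 = 20
  share 1 = 20
  share 2 = 10
  share 3 = 10
  share 4 = 7
  share 5 = 6
  share _ = 0

  -- Turns upper bounds on degrees into lower bounds on what an edge receives.
  share-antitone : ∀ {d e} → d ≤ e → share e ≤ share d
  share-antitone = go ∘ ℕ.≤⇒≤′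
    where
    step : ∀ d → share (suc d) ≤ share d
    step 0 = from-yes (20 ≤? 20)
    step 1 = from-yes (10 ≤? 20)
    step 2 = from-yes (10 ≤? 10)
    step 3 = from-yes (7 ≤? 10)
    step 4 = from-yes (6 ≤? 7)
    step 5 = z≤n
    step (suc (suc (suc (suc (suc (suc _)))))) = z≤n
    go : ∀ {d e} → d ≤′ e → share e ≤ share d
    go (≤′-reflexive refl) = ℕ.≤-refl
    go (≤′-step {n = e} d≤e) = ℕ.≤-trans (step e) (go d≤e)

  *-share≤30 : ∀ d → d * share d ≤ 30
  *-share≤30 0 = z≤n
  *-share≤30 1 = from-yes (20 ≤? 30)
  *-share≤30 2 = from-yes (20 ≤? 30)
  *-share≤30 3 = from-yes (30 ≤? 30)
  *-share≤30 4 = from-yes (28 ≤? 30)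
  *-share≤30 5 = from-yes (30 ≤? 30)
  *-share≤30 d@(suc (suc (suc (suc (suc (suc _)))))) = subst (_≤ 30) (sym (ℕ.*-zeroʳ d)) z≤n

open Counting

-- Edges of a linear 3-graph as lines.

module Incidence {n : ℕ} (G : Linear3Graph n) where

  open import Data.Nat using (_≤_)

  private
    E = edges G

  -- An edge with an ordering of its vertices, so that crowns can be described by positions. That
  -- `set` has no fourth vertex follows from uniformity, in `onLine`.
  record Line (x y z : Fin n) : Set where
    field
      set : Subset n
      ∈E  : set ∈ˡ E
      x∈  : x ∈ set
      y∈  : y ∈ set
      z∈  : z ∈ set
      x≢y : x ≢ y
      x≢z : x ≢ z
      y≢z : y ≢ z

  open Line

  private variable
    a b c d p q r s t u v w x y z : Fin n
    e f g : Subset n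

  rotate : Line x y z → Line y z x
  rotate L = record
    { set = set L ; ∈E = ∈E L ; x∈ = y∈ L ; y∈ = z∈ L ; z∈ = x∈ L
    ; x≢y = y≢z L ; x≢z = x≢y L ∘ sym ; y≢z = x≢z L ∘ sym }

  swap : Line x y z → Line y x z
  swap L = record
    { set = set L ; ∈E = ∈E L ; x∈ = y∈ L ; y∈ = x∈ L ; z∈ = z∈ L
    ; x≢y = x≢y L ∘ sym ; x≢z = y≢z L ; y≢z = x≢z L }

  ∣edge∣ : e ∈ˡ E → ∣ e ∣ ≡ 3
  ∣edge∣ = All.lookup (uniform G)

  edge-unique : e ∈ˡ E → f ∈ˡ E → x ≢ y → x ∈ e → y ∈ e → x ∈ f → y ∈ f → e ≡ f
  edge-unique {e} {f} e∈ f∈ x≢y xe ye xf yf with ≡-dec Bool._≟_ e f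
  ... | yes eq = eq
  ... | no e≢f = contradiction
    (ℕ.≤-trans (length≤∣∣ ((x≢y ∷ []) ∷ [] ∷ []) (x∈p∩q⁺ (xe , xf) ∷ x∈p∩q⁺ (ye , yf) ∷ []))
      (linear G e∈ f∈ e≢f)) λ { (s≤s ()) }

  onLine : (L : Line x y z) → v ∈ set L → v ≡ x ⊎ v ≡ y ⊎ v ≡ z
  onLine {x} {y} {z} {v} L v∈ with v ≟ x | v ≟ y | v ≟ z
  ... | yes v≡x | _       | _       = inj₁ v≡x
  ... | no _    | yes v≡y | _       = inj₂ (inj₁ v≡y)
  ... | no _    | no _    | yes v≡z = inj₂ (inj₂ v≡z)
  ... | no v≢x  | no v≢y  | no v≢z  = contradiction
    (subst (4 ≤_) (∣edge∣ (∈E L))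
      (length≤∣∣ ((v≢x ∷ v≢y ∷ v≢z ∷ []) ∷ (x≢y L ∷ x≢z L ∷ []) ∷ (y≢z L ∷ []) ∷ [] ∷ [])
        (v∈ ∷ x∈ L ∷ y∈ L ∷ z∈ L ∷ [])))
    λ { (s≤s (s≤s (s≤s ()))) }

  line-unique : (L : Line x y z) → f ∈ˡ E → x ∈ f → y ∈ f → set L ≡ f
  line-unique L f∈ xf yf = edge-unique (∈E L) f∈ (x≢y L) (x∈ L) (y∈ L) xf yf

  third : (L : Line x y z) → f ∈ˡ E → x ∈ f → y ∈ f → z ∈ f
  third L f∈ xf yf = subst (_ ∈_) (line-unique L f∈ xf yf) (z∈ L)

  third-unique : Line x y z → Line x y w → z ≡ w
  third-unique L M with onLine M (third L (∈E M) (x∈ M) (y∈ M))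
  ... | inj₁ z≡x        = contradiction (sym z≡x) (x≢z L)
  ... | inj₂ (inj₁ z≡y) = contradiction (sym z≡y) (y≢z L)
  ... | inj₂ (inj₂ z≡w) = z≡w

  edge-vertices : e ∈ˡ E → ∃[ x ] ∃[ y ] ∃[ z ] members e ≡ x ∷ y ∷ z ∷ [] ×
    (∃[ L ] set {x} {y} {z} L ≡ e)
  edge-vertices {e} e∈ with members e in eq | trans (length-members e) (∣edge∣ e∈)
  ... | x ∷ y ∷ z ∷ [] | refl
    with (x≢y ∷ x≢z ∷ []) ∷ (y≢z ∷ []) ∷ [] ∷ [] ← subst Unique eq (filter⁺ (_∈? e) (allFin⁺ n))
       | x∈ ∷ y∈ ∷ z∈ ∷ [] ← subst (All (_∈ e)) eq (all-filter (_∈? e) (allFin n))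
    = x , y , z , refl ,
      record { set = e ; ∈E = e∈ ; x∈ = x∈ ; y∈ = y∈ ; z∈ = z∈
             ; x≢y = x≢y ; x≢z = x≢z ; y≢z = y≢z } , refl

  edge-through : e ∈ˡ E → v ∈ e → ∃[ y ] ∃[ z ] ∃[ L ] set {v} {y} {z} L ≡ e
  edge-through e∈ v∈ with edge-vertices e∈
  ... | x , y , z , _ , L , refl with onLine L v∈
  ...   | inj₁ refl        = y , z , L , refl
  ...   | inj₂ (inj₁ refl) = z , x , rotate L , refl
  ...   | inj₂ (inj₂ refl) = x , y , rotate (rotate L) , refl

  edge-through₂ : e ∈ˡ E → u ∈ e → v ∈ e → u ≢ v → ∃[ w ] ∃[ L ] set {u} {v} {w} L ≡ e
  edge-through₂ e∈ u∈ v∈ u≢v with edge-through e∈ u∈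
  ... | y , z , L , refl with onLine L v∈
  ...   | inj₁ refl        = contradiction refl u≢v
  ...   | inj₂ (inj₁ refl) = z , L , refl
  ...   | inj₂ (inj₂ refl) = y , swap (rotate (rotate L)) , refl

  private
    -- Two edges through `v` share no other vertex, so each point of `S` rules out at most one of
    -- them.
    avoid-among : ∀ {es} → Unique es → (∀ {e} → e ∈ˡ es → e ∈ˡ E × v ∈ e) →
      ∀ S → All (v ≢_) S → length S < length es → ∃[ f ] f ∈ˡ es × All (_∉ f) S
    avoid-among {es = f ∷ _} _  _  []      _          _   = f , here refl , []
    avoid-among {es = es}   es! ok (s ∷ S) (v≢s ∷ v∉) S<
      with f , f∈ , S∉ ← avoid-among (filter⁺ (¬? ∘ (s ∈?_)) es!) (ok ∘ proj₁ ∘ ∈-filter⁻ (¬? ∘ (s ∈?_))) S v∉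
        (s≤s⁻¹ (ℕ.≤-trans S< (length-discard-≤1 (s ∈?_) es! λ e∈ f∈ s∈e s∈f →
          edge-unique (proj₁ (ok e∈)) (proj₁ (ok f∈)) v≢s (proj₂ (ok e∈)) s∈e (proj₂ (ok f∈)) s∈f)))
      with f∈′ , s∉f ← ∈-filter⁻ (¬? ∘ (s ∈?_)) {xs = es} f∈
      = f , f∈′ , s∉f ∷ S∉

  avoid : ∀ S → All (v ≢_) S → length S < degree G v →
    ∃[ f ] f ∈ˡ E × v ∈ f × All (_∉ f) S
  avoid {v} S v∉S S<d
    with f , f∈ , S∉f ← avoid-among (filter⁺ (v ∈?_) (unique G)) (∈-filter⁻ (v ∈?_)) S v∉S S<d
    with f∈E , v∈f ← ∈-filter⁻ (v ∈?_) {xs = E} f∈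
    = f , f∈E , v∈f , S∉f

  -- The trailing `∅` matches the form to which `image` evaluates on a crown edge, whose members are
  -- folded by `⋃`.
  line-∈E : Line x y z → (⁅ x ⁆ ∪ (⁅ y ⁆ ∪ (⁅ z ⁆ ∪ ∅))) ∈ˡ E
  line-∈E {x} {y} {z} L = subst (_∈ˡ E) (⊆-antisym from to) (∈E L)
    where
    from : ∀ {v} → v ∈ set L → v ∈ ⁅ x ⁆ ∪ (⁅ y ⁆ ∪ (⁅ z ⁆ ∪ ∅))
    from v∈ with onLine L v∈
    ... | inj₁ refl        = x∈p∪q⁺ (inj₁ (x∈⁅x⁆ x))
    ... | inj₂ (inj₁ refl) = x∈p∪q⁺ (inj₂ (x∈p∪q⁺ (inj₁ (x∈⁅x⁆ y))))
    ... | inj₂ (inj₂ refl) = x∈p∪q⁺ (inj₂ (x∈p∪q⁺ (inj₂ (x∈p∪q⁺ (inj₁ (x∈⁅x⁆ z))))))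
    to : ∀ {v} → v ∈ ⁅ x ⁆ ∪ (⁅ y ⁆ ∪ (⁅ z ⁆ ∪ ∅)) → v ∈ set L
    to v∈ with x∈p∪q⁻ ⁅ x ⁆ _ v∈
    ... | inj₁ v∈x rewrite x∈⁅y⁆⇒x≡y x v∈x = x∈ L
    ... | inj₂ v∈′ with x∈p∪q⁻ ⁅ y ⁆ _ v∈′
    ...   | inj₁ v∈y rewrite x∈⁅y⁆⇒x≡y y v∈y = y∈ L
    ...   | inj₂ v∈″ with x∈p∪q⁻ ⁅ z ⁆ ∅ v∈″
    ...     | inj₁ v∈z rewrite x∈⁅y⁆⇒x≡y z v∈z = z∈ L
    ...     | inj₂ v∈∅ = contradiction v∈∅ ∉⊥

  -- Assembling a crown from four edges.

  module _ (crown-free : CrownFree G) where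

    -- Disjoint spokes at `a`, `b`, `c` already give nine distinct vertices, as `a`, `b` and `c` lie
    -- on their own spokes.
    no-crown : (K : Line a b c) (L : Line a x y) (M : Line b p q) (N : Line c r s) →
      (∀ {v} → v ∈ set L → v ∈ set M → ⊥) →
      (∀ {v} → v ∈ set L → v ∈ set N → ⊥) →
      (∀ {v} → v ∈ set M → v ∈ set N → ⊥) → ⊥
    no-crown {a} {b} {c} {x} {y} {p} {q} {r} {s} K L M N L∩M L∩N M∩N =
      crown-free (Vec.lookup vs , VecUnique.lookup-injective vs! _ _ , copy)
      where
      vs : Vec (Fin n) 9
      vs = a ∷ b ∷ c ∷ x ∷ y ∷ p ∷ q ∷ r ∷ s ∷ []
      lm : v ∈ set L → w ∈ set M → v ≢ w
      lm v∈ w∈ refl = L∩M v∈ w∈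
      ln : v ∈ set L → w ∈ set N → v ≢ w
      ln v∈ w∈ refl = L∩N v∈ w∈
      mn : v ∈ set M → w ∈ set N → v ≢ w
      mn v∈ w∈ refl = M∩N v∈ w∈
      vs! : VecUnique.Unique vs
      vs! =
        (x≢y K ∷ x≢z K ∷ x≢y L ∷ x≢z L ∷ lm (x∈ L) (y∈ M) ∷ lm (x∈ L) (z∈ M) ∷ ln (x∈ L) (y∈ N) ∷ ln (x∈ L) (z∈ N) ∷ []) ∷
        (y≢z K ∷ lm (y∈ L) (x∈ M) ∘ sym ∷ lm (z∈ L) (x∈ M) ∘ sym ∷ x≢y M ∷ x≢z M ∷ mn (x∈ M) (y∈ N) ∷ mn (x∈ M) (z∈ N) ∷ []) ∷
        (ln (y∈ L) (x∈ N) ∘ sym ∷ ln (z∈ L) (x∈ N) ∘ sym ∷ mn (y∈ M) (x∈ N) ∘ sym ∷ mn (z∈ M) (x∈ N) ∘ sym ∷ x≢y N ∷ x≢z N ∷ []) ∷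
        (y≢z L ∷ lm (y∈ L) (y∈ M) ∷ lm (y∈ L) (z∈ M) ∷ ln (y∈ L) (y∈ N) ∷ ln (y∈ L) (z∈ N) ∷ []) ∷
        (lm (z∈ L) (y∈ M) ∷ lm (z∈ L) (z∈ M) ∷ ln (z∈ L) (y∈ N) ∷ ln (z∈ L) (z∈ N) ∷ []) ∷
        (y≢z M ∷ mn (y∈ M) (y∈ N) ∷ mn (y∈ M) (z∈ N) ∷ []) ∷
        (mn (z∈ M) (y∈ N) ∷ mn (z∈ M) (z∈ N) ∷ []) ∷
        (y≢z N ∷ []) ∷ [] ∷ []
      copy : ∀ {e} → e ∈ˡ edges C₁₃ → image (Vec.lookup vs) e ∈ˡ E
      copy (here refl)                         = line-∈E K
      copy (there (here refl))                 = line-∈E L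
      copy (there (there (here refl)))         = line-∈E M
      copy (there (there (there (here refl)))) = line-∈E N

    -- All other disjointness and distinctness requirements of a crown follow from
    -- linearity.
    crown : Line a b c → f ∈ˡ E → a ∈ f → (M : Line b p q) → Line c r s →
      All (_∉ f) (b ∷ p ∷ q ∷ r ∷ s ∷ []) → All (_∉ set M) (r ∷ s ∷ []) → ⊥
    crown {b = b} {c = c} {f = f} {p = p} {q = q} {r = r} {s = s} K f∈ af M N
      (b∉ ∷ p∉ ∷ q∉ ∷ r∉ ∷ s∉ ∷ []) (r∉M ∷ s∉M ∷ [])
      with _ , _ , L , refl ← edge-through f∈ af = no-crown K L M N
      (λ v∈L v∈M → case-M v∈L (onLine M v∈M))
      (λ v∈L v∈N → case-N v∈L (onLine N v∈N))
      (λ v∈M v∈N → case-MN v∈M (onLine N v∈N))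
      where
      case-M : v ∈ f → v ≡ b ⊎ v ≡ p ⊎ v ≡ q → ⊥
      case-M v∈ (inj₁ refl)        = b∉ v∈
      case-M v∈ (inj₂ (inj₁ refl)) = p∉ v∈
      case-M v∈ (inj₂ (inj₂ refl)) = q∉ v∈
      case-N : v ∈ f → v ≡ c ⊎ v ≡ r ⊎ v ≡ s → ⊥
      case-N v∈ (inj₁ refl)        = b∉ (third (swap (rotate (rotate K))) f∈ af v∈)
      case-N v∈ (inj₂ (inj₁ refl)) = r∉ v∈
      case-N v∈ (inj₂ (inj₂ refl)) = s∉ v∈
      case-MN : v ∈ set M → v ≡ c ⊎ v ≡ r ⊎ v ≡ s → ⊥
      case-MN v∈ (inj₁ refl)        = case-M af (onLine M (third (rotate K) (∈E M) (x∈ M) v∈))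
      case-MN v∈ (inj₂ (inj₁ refl)) = r∉M v∈
      case-MN v∈ (inj₂ (inj₂ refl)) = s∉M v∈

-- The configuration of two K₄'s and its symmetries.

-- Names for the vertices of the configuration around a heavy edge abc, which is
-- embedded into the graph by a map ψ; its symmetries act by precomposition.
pattern 𝐚  = 0F
pattern 𝐛  = 1F
pattern 𝐜  = 2F
pattern 𝐱  = 3F
pattern 𝐲  = 4F
pattern 𝐩  = 5F
pattern 𝐪  = 6F
pattern 𝐱′ = 7F
pattern 𝐲′ = 8F
pattern 𝐩′ = 9F
pattern 𝐪′ = suc 9F

-- `σ-xy` and `σ-xp` generate the Klein four-group on the first K₄, which preserves its three
-- perfect matchings; `σ-′` exchanges the two K₄'s.
σ-xy : Fin 11 → Fin 11
σ-xy 𝐱 = 𝐲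
σ-xy 𝐲 = 𝐱
σ-xy 𝐩 = 𝐪
σ-xy 𝐪 = 𝐩
σ-xy i = i

σ-xp : Fin 11 → Fin 11
σ-xp 𝐱 = 𝐩
σ-xp 𝐩 = 𝐱
σ-xp 𝐲 = 𝐪
σ-xp 𝐪 = 𝐲
σ-xp i = i

σ-′ : Fin 11 → Fin 11
σ-′ 𝐱 = 𝐱′
σ-′ 𝐲 = 𝐲′
σ-′ 𝐩 = 𝐩′
σ-′ 𝐪 = 𝐪′
σ-′ 𝐱′ = 𝐱
σ-′ 𝐲′ = 𝐲
σ-′ 𝐩′ = 𝐩
σ-′ 𝐪′ = 𝐪
σ-′ i = i

module Crownless {n : ℕ} (G : Linear3Graph n) (crown-free : CrownFree G) where

  open import Data.Nat using (_≤_)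

  open Incidence G
  open Line

  private
    E = edges G
    deg = degree G
    variable
      a b c d p q r s t u v w x y z : Fin n
      e f g : Subset n
      ψ : Fin 11 → Fin n

  flip : Line x y z → Line x z y
  flip = swap ∘ rotate ∘ rotate

  -- A K₄ on x, y, p, q whose perfect matchings are completed to edges by a, b and
  -- c, except that the pair pq is not required to form an edge with c.
  record Quad (a b c x y p q : Fin n) : Set where
    field
      axp : Line a x p
      ayq : Line a y q
      bxq : Line b x q
      byp : Line b y p
      cxy : Line c x y

    vertices : Vec (Fin n) 4
    vertices = x ∷ y ∷ p ∷ q ∷ []

    p≢q : p ≢ q
    p≢q refl = y≢z cxy (third-unique (flip axp) (flip ayq))

    vertices! : VecUnique.Unique vertices
    vertices! = (y≢z cxy ∷ y≢z axp ∷ y≢z bxq ∷ []) ∷ (y≢z byp ∷ y≢z ayq ∷ []) ∷ (p≢q ∷ []) ∷ [] ∷ []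

    module _ (K : Line a b c) where

      -- With `c` equal to `p`, the edge `axp` would be `abc`, so `x` would be `b`, against `bxq`.
      c≢p : c ≢ p
      c≢p refl = x≢y bxq (sym (third-unique (flip axp) (flip K)))

      c≢q : c ≢ q
      c≢q refl = x≢y byp (sym (third-unique (flip ayq) (flip K)))

      vertices-≢ : VecAll.All (λ u → VecAll.All (u ≢_) vertices) (a ∷ b ∷ c ∷ [])
      vertices-≢ =
        (x≢y axp ∷ x≢y ayq ∷ x≢z axp ∷ x≢z ayq ∷ []) ∷
        (x≢y bxq ∷ x≢y byp ∷ x≢z byp ∷ x≢z bxq ∷ []) ∷
        (x≢y cxy ∷ x≢z cxy ∷ c≢p ∷ c≢q ∷ []) ∷ []

  open Quad

  flip-quad : Quad a b c x y p q → Quad a b c y x q p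
  flip-quad Q = record
    { axp = ayq Q ; ayq = axp Q ; bxq = byp Q ; byp = bxq Q ; cxy = flip (cxy Q) }

  turn-quad : Quad a b c x y p q → Line c p q → Quad a b c p q x y
  turn-quad Q cpq = record
    { axp = flip (axp Q) ; ayq = flip (ayq Q) ; bxq = flip (byp Q) ; byp = flip (bxq Q) ; cxy = cpq }

  record TwoQuads (ψ : Fin 11 → Fin n) : Set where
    field
      injective : Injective _≡_ _≡_ ψ
      quad  : Quad (ψ 𝐚) (ψ 𝐛) (ψ 𝐜) (ψ 𝐱) (ψ 𝐲) (ψ 𝐩) (ψ 𝐪)
      quad′ : Quad (ψ 𝐚) (ψ 𝐛) (ψ 𝐜) (ψ 𝐱′) (ψ 𝐲′) (ψ 𝐩′) (ψ 𝐪′)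

    -- At concrete indices the three `False` arguments are solved by evaluation.
    off : ∀ {i j k l} {i≢l : False (i ≟ l)} {j≢l : False (j ≟ l)} {k≢l : False (k ≟ l)} →
      (L : Line (ψ i) (ψ j) (ψ k)) → ψ l ∉ set L
    off {i≢l = i≢l} {j≢l} {k≢l} L l∈ with onLine L l∈
    ... | inj₁ eq        = toWitnessFalse i≢l (injective (sym eq))
    ... | inj₂ (inj₁ eq) = toWitnessFalse j≢l (injective (sym eq))
    ... | inj₂ (inj₂ eq) = toWitnessFalse k≢l (injective (sym eq))

  open TwoQuads

  injective-∘ : ∀ {σ} → Injective _≡_ _≡_ ψ → (∀ i → σ (σ i) ≡ i) → Injective _≡_ _≡_ (ψ ∘ σ)
  injective-∘ {σ = σ} inj σσ {i} {j} eq = trans (sym (σσ i)) (trans (cong σ (inj eq)) (σσ j))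

  swap-xy : TwoQuads ψ → TwoQuads (ψ ∘ σ-xy)
  swap-xy T = record
    { injective = injective-∘ {σ = σ-xy} (injective T) (from-yes (all? λ i → σ-xy (σ-xy i) ≟ i))
    ; quad = flip-quad (quad T) ; quad′ = quad′ T }

  swap-xp : TwoQuads ψ → Line (ψ 𝐜) (ψ 𝐩) (ψ 𝐪) → TwoQuads (ψ ∘ σ-xp)
  swap-xp T cpq = record
    { injective = injective-∘ {σ = σ-xp} (injective T) (from-yes (all? λ i → σ-xp (σ-xp i) ≟ i))
    ; quad = turn-quad (quad T) cpq ; quad′ = quad′ T }

  swap-′ : TwoQuads ψ → TwoQuads (ψ ∘ σ-′)
  swap-′ T = record
    { injective = injective-∘ {σ = σ-′} (injective T) (from-yes (all? λ i → σ-′ (σ-′ i) ≟ i))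
    ; quad = quad′ T ; quad′ = quad T }

  points : (Fin 11 → Fin n) → List (Fin n)
  points ψ = tabulate (λ i → ψ (3 ↑ʳ i))

  -- Edges avoiding `a`, `b`, `c` and the eight points.

  module _ (f∈ : f ∈ˡ E) where

    exclude : Line u v w → u ∈ f → w ∉ f → v ∉ f
    exclude L u∈ w∉ v∈ = w∉ (third L f∈ u∈ v∈)

    module _ (T : TwoQuads ψ) (cpq : Line (ψ 𝐜) (ψ 𝐩) (ψ 𝐪))
      (a∉ : ψ 𝐚 ∉ f) (b∉ : ψ 𝐛 ∉ f) (c∉ : ψ 𝐜 ∉ f) where

      private
        -- All six pairs of the first K₄ are completed to edges by `a`, `b` or `c`, so `f` has at
        -- most one vertex there and misses the pair of one of its two a-edges.
        a-line-missed : ψ 𝐱 ∉ f × ψ 𝐩 ∉ f ⊎ ψ 𝐲 ∉ f × ψ 𝐪 ∉ f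
        a-line-missed with ψ 𝐱 ∈? f | ψ 𝐩 ∈? f
        ... | no x∉  | no p∉  = inj₁ (x∉ , p∉)
        ... | yes x∈ | _      = inj₂ (exclude (rotate (cxy (quad T))) x∈ c∉ , exclude (rotate (bxq (quad T))) x∈ b∉)
        ... | no _   | yes p∈ = inj₂ (exclude (swap (rotate (byp (quad T)))) p∈ b∉ , exclude (rotate cpq) p∈ c∉)

      -- Every case extends f to a crown whose central edge is axp, except when f is
      -- xp′q′, where the central edge is ax′p′.
      x∉ : ψ 𝐱 ∉ f
      x∉ x∈ with ψ 𝐱′ ∈? f | ψ 𝐩′ ∈? f | ψ 𝐪′ ∈? f
      ... | no x′∉ | no p′∉ | _ =
        crown crown-free (rotate (axp (quad T))) f∈ x∈ (rotate (rotate (byp (quad T)))) (axp (quad′ T))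
          (exclude (rotate (axp (quad T))) x∈ a∉ ∷ b∉ ∷ exclude (rotate (cxy (quad T))) x∈ c∉ ∷ x′∉ ∷ p′∉ ∷ [])
          (off T (byp (quad T)) ∷ off T (byp (quad T)) ∷ [])
      ... | yes x′∈ | _ | _ =
        crown crown-free (rotate (axp (quad T))) f∈ x∈ (rotate (rotate (byp (quad T)))) (ayq (quad′ T))
          (exclude (rotate (axp (quad T))) x∈ a∉ ∷ b∉ ∷ exclude (rotate (cxy (quad T))) x∈ c∉ ∷
            exclude (rotate (cxy (quad′ T))) x′∈ c∉ ∷ exclude (rotate (bxq (quad′ T))) x′∈ b∉ ∷ [])
          (off T (byp (quad T)) ∷ off T (byp (quad T)) ∷ [])
      ... | no _ | yes p′∈ | no q′∉ =
        crown crown-free (rotate (axp (quad T))) f∈ x∈ (rotate (rotate (byp (quad T)))) (ayq (quad′ T))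
          (exclude (rotate (axp (quad T))) x∈ a∉ ∷ b∉ ∷ exclude (rotate (cxy (quad T))) x∈ c∉ ∷
            exclude (swap (rotate (byp (quad′ T)))) p′∈ b∉ ∷ q′∉ ∷ [])
          (off T (byp (quad T)) ∷ off T (byp (quad T)) ∷ [])
      ... | no x′∉ | yes p′∈ | yes _ =
        crown crown-free (swap (rotate (axp (quad′ T)))) f∈ p′∈ (swap (cxy (quad′ T))) (ayq (quad T))
          (x′∉ ∷ c∉ ∷ exclude (swap (rotate (byp (quad′ T)))) p′∈ b∉ ∷
            exclude (rotate (cxy (quad T))) x∈ c∉ ∷ exclude (rotate (bxq (quad T))) x∈ b∉ ∷ [])
          (off T (cxy (quad′ T)) ∷ off T (cxy (quad′ T)) ∷ [])

      -- The pair `p′q′` need not form an edge with `c`, so `swap-xp` has no primed counterpart and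
      -- `x′` and `p′` are treated separately. The central edge is `ax′p′`, with spokes `f`, `p′by′`
      -- and the a-edge from `a-line-missed`.
      x′∉ : ψ 𝐱′ ∉ f
      x′∉ x′∈ with a-line-missed
      ... | inj₁ (x∉ , p∉) = crown crown-free (rotate (axp (quad′ T))) f∈ x′∈ (rotate (rotate (byp (quad′ T)))) (axp (quad T))
          (exclude (rotate (axp (quad′ T))) x′∈ a∉ ∷ b∉ ∷ exclude (rotate (cxy (quad′ T))) x′∈ c∉ ∷ x∉ ∷ p∉ ∷ [])
          (off T (byp (quad′ T)) ∷ off T (byp (quad′ T)) ∷ [])
      ... | inj₂ (y∉ , q∉) = crown crown-free (rotate (axp (quad′ T))) f∈ x′∈ (rotate (rotate (byp (quad′ T)))) (ayq (quad T))
          (exclude (rotate (axp (quad′ T))) x′∈ a∉ ∷ b∉ ∷ exclude (rotate (cxy (quad′ T))) x′∈ c∉ ∷ y∉ ∷ q∉ ∷ [])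
          (off T (byp (quad′ T)) ∷ off T (byp (quad′ T)) ∷ [])

      p′∉ : ψ 𝐩′ ∉ f
      p′∉ p′∈ with a-line-missed
      ... | inj₁ (x∉ , p∉) = crown crown-free (swap (rotate (axp (quad′ T)))) f∈ p′∈ (swap (cxy (quad′ T))) (axp (quad T))
          (x′∉ ∷ c∉ ∷ exclude (swap (rotate (byp (quad′ T)))) p′∈ b∉ ∷ x∉ ∷ p∉ ∷ [])
          (off T (cxy (quad′ T)) ∷ off T (cxy (quad′ T)) ∷ [])
      ... | inj₂ (y∉ , q∉) = crown crown-free (swap (rotate (axp (quad′ T)))) f∈ p′∈ (swap (cxy (quad′ T))) (ayq (quad T))
          (x′∉ ∷ c∉ ∷ exclude (swap (rotate (byp (quad′ T)))) p′∈ b∉ ∷ y∉ ∷ q∉ ∷ [])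
          (off T (cxy (quad′ T)) ∷ off T (cxy (quad′ T)) ∷ [])

    points-avoided : TwoQuads ψ → Line (ψ 𝐜) (ψ 𝐩) (ψ 𝐪) → ψ 𝐚 ∉ f → ψ 𝐛 ∉ f → ψ 𝐜 ∉ f →
      All (_∉ f) (points ψ)
    points-avoided T cpq a∉ b∉ c∉ =
      x∉ T cpq a∉ b∉ c∉ ∷
      x∉ (swap-xy T) (flip cpq) a∉ b∉ c∉ ∷
      x∉ (swap-xp T cpq) (cxy (quad T)) a∉ b∉ c∉ ∷
      x∉ (swap-xy (swap-xp T cpq)) (flip (cxy (quad T))) a∉ b∉ c∉ ∷
      x′∉ T cpq a∉ b∉ c∉ ∷
      x′∉ T′ cpq a∉ b∉ c∉ ∷
      p′∉ T cpq a∉ b∉ c∉ ∷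
      p′∉ T′ cpq a∉ b∉ c∉ ∷ []
      -- `swap-xy` conjugated by `swap-′`: it exchanges `x′` with `y′` and `p′` with `q′`.
      where T′ = swap-′ (swap-xy (swap-′ T))

  points-≢ : (T : TwoQuads ψ) → All (λ v → All (v ≢_) (ψ 𝐚 ∷ ψ 𝐛 ∷ ψ 𝐜 ∷ [])) (points ψ)
  points-≢ {ψ} T = ne {𝐱} ∷ ne {𝐲} ∷ ne {𝐩} ∷ ne {𝐪} ∷ ne {𝐱′} ∷ ne {𝐲′} ∷ ne {𝐩′} ∷ ne {𝐪′} ∷ []
    where
    ne : ∀ {i} {i≢a : False (i ≟ 𝐚)} {i≢b : False (i ≟ 𝐛)} {i≢c : False (i ≟ 𝐜)} →
      All (ψ i ≢_) (ψ 𝐚 ∷ ψ 𝐛 ∷ ψ 𝐜 ∷ [])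
    ne {i} {i≢a} {i≢b} {i≢c} =
      toWitnessFalse i≢a ∘ injective T ∷ toWitnessFalse i≢b ∘ injective T ∷ toWitnessFalse i≢c ∘ injective T ∷ []

  -- At most three edges through `v` contain `a`, `b` or `c`; a fourth would avoid all three,
  -- against `points-avoided`.
  degree≤3 : TwoQuads ψ → Line (ψ 𝐜) (ψ 𝐩) (ψ 𝐪) → v ∈ˡ points ψ → deg v ≤ 3
  degree≤3 {ψ} {v} T cpq v∈ = ℕ.≮⇒≥ λ 3<d →
    let f , f∈ , v∈f , S∉ = avoid (ψ 𝐚 ∷ ψ 𝐛 ∷ ψ 𝐜 ∷ []) (All.lookup (points-≢ T) v∈) 3<d
        a∉ , b∉ , c∉ = unpack S∉
    in All.lookup (points-avoided f∈ T cpq a∉ b∉ c∉) v∈ v∈f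
    where
    unpack : ∀ {P : Fin n → Set} → All P (a ∷ b ∷ c ∷ []) → P a × P b × P c
    unpack (a ∷ b ∷ c ∷ []) = a , b , c

  -- Greedy crowns around an edge of high degrees.

  Disjoint : Line a b c → Line x y z → Set
  Disjoint L M = ∀ {v} → v ∈ set L → v ∈ set M → ⊥

  off₃ : (L : Line x y z) → x ∉ f → y ∉ f → z ∉ f → ∀ {v} → v ∈ set L → v ∉ f
  off₃ L x∉ y∉ z∉ v∈ with onLine L v∈
  ... | inj₁ refl        = x∉
  ... | inj₂ (inj₁ refl) = y∉
  ... | inj₂ (inj₂ refl) = z∉

  other-∉ : Line a b c → f ∈ˡ E → b ∈ f → a ∉ f → c ∉ f
  other-∉ K f∈ b∈ a∉ c∈ = a∉ (third (rotate K) f∈ b∈ c∈)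

  avoid-line : ∀ S → All (v ≢_) S → length S < deg v →
    ∃[ y ] ∃[ z ] ∃[ L ] All (_∉ set {v} {y} {z} L) S
  avoid-line S v∉S S<d
    with f , f∈ , v∈f , S∉f ← avoid S v∉S S<d
    with y , z , L , refl ← edge-through f∈ v∈f = y , z , L , S∉f

  other-edge : e ∈ˡ E → f ∈ˡ E → u ≢ v → u ∈ e → u ∈ f → v ∈ f → w ∈ e → w ∉ f → v ∉ e
  other-edge e∈ f∈ u≢v ue uf vf we w∉f ve = w∉f (subst (_ ∈_) (edge-unique e∈ f∈ u≢v ue ve uf vf) we)

  ∉⇒≢ : v ∈ e → w ∉ e → v ≢ w
  ∉⇒≢ v∈ w∉ refl = w∉ v∈

  -- Spokes are picked at `c`, then `b`, then `a`, avoiding 1, 3 and 5 points; hence the degrees 2,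
  -- 4 and 6.
  no-high-edge : Line a b c → 6 ≤ deg a → 4 ≤ deg b → 2 ≤ deg c → ⊥
  no-high-edge {a} {b} {c} K da db dc
    with h , i , N , a∉N ∷ [] ← avoid-line (a ∷ []) (x≢z K ∘ sym ∷ []) dc
    with b∉N ← other-∉ (swap (rotate (rotate K))) (∈E N) (x∈ N) a∉N
    with f , g , M , a∉M ∷ h∉M ∷ i∉M ∷ [] ← avoid-line (a ∷ h ∷ i ∷ [])
           (x≢y K ∘ sym ∷ ∉⇒≢ (y∈ N) b∉N ∘ sym ∷ ∉⇒≢ (z∈ N) b∉N ∘ sym ∷ []) db
    with e , e∈ , a∈e , S∉e ← avoid (b ∷ f ∷ g ∷ h ∷ i ∷ [])
           (x≢y K ∷ ∉⇒≢ (y∈ M) a∉M ∘ sym ∷ ∉⇒≢ (z∈ M) a∉M ∘ sym ∷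
            ∉⇒≢ (y∈ N) a∉N ∘ sym ∷ ∉⇒≢ (z∈ N) a∉N ∘ sym ∷ []) da
    = crown crown-free K e∈ a∈e M N S∉e (h∉M ∷ i∉M ∷ [])

  -- If the edges M and N are disjoint, crown-freeness makes each of the at least four
  -- a-edges other than abc contain one of the four points s, t, u, v.  As a-edges
  -- only share a, each of these points is on an a-edge, and no a-edge contains two.
  cover : Line a b c → 5 ≤ deg a → (M : Line b s t) (N : Line c u v) →
    a ∉ set M → a ∉ set N → Disjoint N M → ∃[ w ] Line a s w
  cover {a} {b} {c} {s} {t} {u} {v} K da M N a∉M a∉N N∩M
    with any? (λ e → (a ∈? e) ×-dec (s ∈? e)) E
  ... | yes any with e , e∈ , a∈ , s∈ ← find any
                with w , L , _ ← edge-through₂ e∈ a∈ s∈ (∉⇒≢ (y∈ M) a∉M ∘ sym) = w , L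
  ... | no none
    with e , e∈ , a∈ , b∉ ∷ t∉ ∷ u∉ ∷ v∉ ∷ [] ← avoid (b ∷ t ∷ u ∷ v ∷ [])
           (x≢y K ∷ ∉⇒≢ (z∈ M) a∉M ∘ sym ∷ ∉⇒≢ (y∈ N) a∉N ∘ sym ∷ ∉⇒≢ (z∈ N) a∉N ∘ sym ∷ []) da
    = ⊥-elim (crown crown-free K e∈ a∈ M N
        (b∉ ∷ (λ s∈ → none (lose e∈ (a∈ , s∈))) ∷ t∉ ∷ u∉ ∷ v∉ ∷ []) (N∩M (y∈ N) ∷ N∩M (z∈ N) ∷ []))

  -- If `asu` is an edge, an a-edge missing `s` misses `u` too. Avoiding `b`, `s`, `t` and `v` then
  -- suffices for a crown, which degree 5 permits.
  no-transversal : Line a b c → 5 ≤ deg a → (M : Line b s t) (N : Line c u v) →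
    a ∉ set M → a ∉ set N → Disjoint N M → ¬ Line a s u
  no-transversal {a} {b} {c} {s} {t} {u} {v} K da M N a∉M a∉N N∩M L
    with e , e∈ , a∈ , b∉ ∷ s∉ ∷ t∉ ∷ v∉ ∷ [] ← avoid (b ∷ s ∷ t ∷ v ∷ [])
           (x≢y K ∷ x≢y L ∷ ∉⇒≢ (z∈ M) a∉M ∘ sym ∷ ∉⇒≢ (z∈ N) a∉N ∘ sym ∷ []) da
    = crown crown-free K e∈ a∈ M N
        (b∉ ∷ s∉ ∷ t∉ ∷ exclude e∈ (flip L) a∈ s∉ ∷ v∉ ∷ []) (N∩M (y∈ N) ∷ N∩M (z∈ N) ∷ [])

  -- Local structure at a heavy edge.

  module HeavyEdge (K : Line a b c) (da : 5 ≤ deg a) (db : 5 ≤ deg b) (dc : 4 ≤ deg c) where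

    -- A b-edge `B` disjoint from `C` yields the a-edge `axp` through `cover` at `a`. A c-edge `D`
    -- disjoint from `axp` yields a b-edge `R` on `p` through `cover` at `b`. If `R` missed `y`, it
    -- would be disjoint from `C`, and `axp` would be a transversal of `R` and `C`.
    quad-side : (C : Line c x y) → a ∉ set C → ∃[ p ] Line a x p × Line b p y
    quad-side {x} {y} C a∉C
      with b∉C ← other-∉ (swap (rotate (rotate K))) (∈E C) (x∈ C) a∉C
      with f , g , B , a∉B ∷ x∉B ∷ y∉B ∷ [] ← avoid-line (a ∷ x ∷ y ∷ [])
             (x≢y K ∘ sym ∷ ∉⇒≢ (y∈ C) b∉C ∘ sym ∷ ∉⇒≢ (z∈ C) b∉C ∘ sym ∷ [])
             (ℕ.≤-trans (s≤s (s≤s (s≤s (s≤s z≤n)))) db)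
      with c∉B ← other-∉ K (∈E B) (x∈ B) a∉B
      with p , A ← cover (flip K) da C B a∉C a∉B (λ v∈B v∈C → off₃ C c∉B x∉B y∉B v∈C v∈B)
      with c∉A ← other-edge (∈E A) (∈E C) (x≢y C ∘ sym) (y∈ A) (y∈ C) (x∈ C) (x∈ A) a∉C
      with b∉A ← exclude (∈E A) K (x∈ A) c∉A
      with u , v , D , a∉D ∷ x∉D ∷ p∉D ∷ [] ← avoid-line (a ∷ x ∷ p ∷ [])
             (x≢z K ∘ sym ∷ x≢y C ∷ ∉⇒≢ (z∈ A) c∉A ∘ sym ∷ []) dc
      with b∉D ← other-∉ (swap (rotate (rotate K))) (∈E D) (x∈ D) a∉D
      with r , R ← cover (swap K) db (flip A) D b∉A b∉D (λ v∈D v∈A → off₃ A a∉D x∉D p∉D v∈A v∈D)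
      with a∉R ← other-edge (∈E R) (∈E A) (x≢z A ∘ sym) (y∈ R) (z∈ A) (x∈ A) (x∈ R) b∉A
      with y ∈? set R
    ... | no y∉R = ⊥-elim (no-transversal K da R C a∉R a∉C
            (λ v∈C v∈R → off₃ C (other-∉ K (∈E R) (x∈ R) a∉R)
               (other-edge (∈E R) (∈E A) (y≢z A ∘ sym) (y∈ R) (z∈ A) (y∈ A) (x∈ R) b∉A) y∉R v∈C v∈R) (flip A))
    ... | yes y∈R with onLine R y∈R
    ...   | inj₁ refl        = contradiction (z∈ C) b∉C
    ...   | inj₂ (inj₂ refl) = p , A , R
    ...   | inj₂ (inj₁ refl) =
      contradiction (z∈ C) (other-edge (∈E C) (∈E A) (y≢z A) (y∈ C) (y∈ A) (z∈ A) (x∈ C) c∉A)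

    quad-on : (C : Line c x y) → a ∉ set C → ∃[ p ] ∃[ q ] Quad a b c x y p q
    quad-on C a∉C
      with p , axp , byp ← quad-side C a∉C
      with q , ayq , bxq ← quad-side (flip C) a∉C
      = p , q , record { axp = axp ; ayq = ayq ; bxq = flip bxq ; byp = flip byp ; cxy = C }

    -- The quad on the c-edge cpw contains the a-partner x of p, and then w is the
    -- b-partner q of x.
    cp-line : Quad a b c x y p q → e ∈ˡ E → c ∈ e → a ∉ e → p ∈ e → Line c p q
    cp-line Q e∈ c∈ a∉ p∈
      with w , C , refl ← edge-through₂ e∈ c∈ p∈ (c≢p Q K)
      with x′ , A , B ← quad-side C a∉
      with refl ← third-unique (flip (axp Q)) A
      with refl ← third-unique (bxq Q) B
      = C

    -- Degree 4 at `c` leaves a c-edge `C′` avoiding `a`, `x` and `p`. It also misses `y`, which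
    -- lies on `cxy`, and `q`, since by `cp-line` a c-edge on `q` without `a` contains `p`.
    two-quads : ∃[ vs ] TwoQuads (Vec.lookup (a ∷ b ∷ c ∷ vs))
    two-quads
      with x , y , C , a∉C ∷ [] ← avoid-line (a ∷ []) (x≢z K ∘ sym ∷ []) (ℕ.≤-trans (s≤s (s≤s z≤n)) dc)
      with p , q , Q ← quad-on C a∉C
      with x′ , y′ , C′ , a∉C′ ∷ x∉C′ ∷ p∉C′ ∷ [] ← avoid-line (a ∷ x ∷ p ∷ [])
             (x≢z K ∘ sym ∷ x≢y C ∷ c≢p Q K ∷ []) dc
      with p′ , q′ , Q′ ← quad-on C′ a∉C′
      with a≢ ∷ b≢ ∷ c≢ ∷ [] ← vertices-≢ Q K | a≢′ ∷ b≢′ ∷ c≢′ ∷ [] ← vertices-≢ Q′ K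
      = x ∷ y ∷ p ∷ q ∷ x′ ∷ y′ ∷ p′ ∷ q′ ∷ [] , record
        { injective = VecUnique.lookup-injective
            (VecAllPairs.++⁺ ((x≢y K ∷ x≢z K ∷ []) ∷ (y≢z K ∷ []) ∷ [] ∷ [])
              (VecAllPairs.++⁺ (vertices! Q) (vertices! Q′) disjoint)
              (VecAll.++⁺ a≢ a≢′ ∷ VecAll.++⁺ b≢ b≢′ ∷ VecAll.++⁺ c≢ c≢′ ∷ [])) _ _
        ; quad = Q ; quad′ = Q′ }
      where
      y∉C′ : y ∉ set C′
      y∉C′ = exclude (∈E C′) (flip C) (x∈ C′) x∉C′
      q∉C′ : q ∉ set C′
      q∉C′ q∈ = p∉C′ (third (cp-line (flip-quad Q) (∈E C′) (x∈ C′) a∉C′ q∈) (∈E C′) (x∈ C′) q∈)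
      apart : Line a v w → v ∉ set C′ → w ∉ set C′ → VecAll.All (v ≢_) (vertices Q′)
      apart L v∉ w∉ = (∉⇒≢ (y∈ C′) v∉ ∘ sym) ∷ (∉⇒≢ (z∈ C′) v∉ ∘ sym) ∷
        -- If `v` were `p′`, linearity would identify `w` with `x′`, a point of `C′`; likewise for
        -- `q′` and `y′`.
        (λ { refl → w∉ (subst (_∈ set C′) (third-unique (flip (axp Q′)) L) (y∈ C′)) }) ∷
        (λ { refl → w∉ (subst (_∈ set C′) (third-unique (flip (ayq Q′)) L) (z∈ C′)) }) ∷ []
      disjoint : VecAll.All (λ v → VecAll.All (v ≢_) (vertices Q′)) (vertices Q)
      disjoint = apart (axp Q) x∉C′ p∉C′ ∷ apart (ayq Q) y∉C′ q∉C′ ∷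
        apart (flip (axp Q)) p∉C′ x∉C′ ∷ apart (flip (ayq Q)) q∉C′ y∉C′ ∷ []

  module _ (T : TwoQuads ψ) (K : Line (ψ 𝐚) (ψ 𝐛) (ψ 𝐜))
    (da : 5 ≤ deg (ψ 𝐚)) (db : 5 ≤ deg (ψ 𝐛)) (dc : 4 ≤ deg (ψ 𝐜)) where

    open HeavyEdge K da db dc

    -- A c-edge avoiding both quads would come with an a-edge avoiding both quads, and
    -- hence with the crown around abc using bx′q′ and cxy.
    full-quad : Line (ψ 𝐜) (ψ 𝐩) (ψ 𝐪) ⊎ Line (ψ 𝐜) (ψ 𝐩′) (ψ 𝐪′)
    full-quad
      with u , v , C , a∉C ∷ x∉C ∷ x′∉C ∷ [] ← avoid-line (ψ 𝐚 ∷ ψ 𝐱 ∷ ψ 𝐱′ ∷ [])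
             (x≢z K ∘ sym ∷ x≢y (cxy (quad T)) ∷ x≢y (cxy (quad′ T)) ∷ []) dc
      with ψ 𝐩 ∈? set C | ψ 𝐪 ∈? set C | ψ 𝐩′ ∈? set C | ψ 𝐪′ ∈? set C
    ... | yes p∈ | _ | _ | _ = inj₁ (cp-line (quad T) (∈E C) (x∈ C) a∉C p∈)
    ... | no _ | yes q∈ | _ | _ = inj₁ (flip (cp-line (flip-quad (quad T)) (∈E C) (x∈ C) a∉C q∈))
    ... | no _ | no _ | yes p′∈ | _ = inj₂ (cp-line (quad′ T) (∈E C) (x∈ C) a∉C p′∈)
    ... | no _ | no _ | no _ | yes q′∈ = inj₂ (flip (cp-line (flip-quad (quad′ T)) (∈E C) (x∈ C) a∉C q′∈))
    ... | no p∉C | no q∉C | no p′∉C | no q′∉C with w , A , _ ← quad-side C a∉C =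
      ⊥-elim (crown crown-free K (∈E A) (x∈ A) (bxq (quad′ T)) (cxy (quad T))
        (exclude (∈E A) K (x∈ A) (other-edge (∈E A) (∈E C) (x≢y C ∘ sym) (y∈ A) (y∈ C) (x∈ C) (x∈ A) a∉C) ∷
          missed (axp (quad′ T)) x′∉C p′∉C ∷
          missed (flip (ayq (quad′ T))) q′∉C y′∉C ∷
          missed (axp (quad T)) x∉C p∉C ∷
          missed (ayq (quad T)) y∉C q∉C ∷ [])
        (off T (bxq (quad′ T)) ∷ off T (bxq (quad′ T)) ∷ []))
      where
      y∉C : ψ 𝐲 ∉ set C
      y∉C = exclude (∈E C) (flip (cxy (quad T))) (x∈ C) x∉C
      y′∉C : ψ 𝐲′ ∉ set C
      y′∉C = exclude (∈E C) (flip (cxy (quad′ T))) (x∈ C) x′∉C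
      -- Otherwise `A` is the edge of `L`, and its vertex `u` on `C` is one of `ψ 𝐚`, `s`, `t`, none
      -- of which `C` contains.
      missed : Line (ψ 𝐚) s t → s ∉ set C → t ∉ set C → s ∉ set A
      missed L s∉ t∉ s∈ = off₃ L a∉C s∉ t∉ (subst (u ∈_) (sym (line-unique L (∈E A) (x∈ A) s∈)) (y∈ A)) (y∈ C)

    private
      on : (L : Line x y z) → f ∈ˡ E → x ∈ f → y ∈ f → v ∈ f → v ≢ x → v ≡ y ⊎ v ≡ z
      on L f∈ x∈ y∈ v∈ v≢x with onLine L (subst (_ ∈_) (sym (line-unique L f∈ x∈ y∈)) v∈)
      ... | inj₁ v≡x = contradiction v≡x v≢x
      ... | inj₂ eq  = eq

      at : ∀ i → v ≡ ψ (3 ↑ʳ i) → v ∈ˡ points ψ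
      at i refl = ∈-tabulate⁺ {f = λ j → ψ (3 ↑ʳ j)} i

    -- The disjoint edges `bx′q′` and `cxy` force `f` through one of `x`, `y`, `x′`, `q′`, which lie
    -- on the four a-edges of the two quads.
    a-neighbour : f ∈ˡ E → ψ 𝐚 ∈ f → ψ 𝐛 ∉ f → v ∈ f → v ≢ ψ 𝐚 → v ∈ˡ points ψ
    a-neighbour {f} f∈ a∈ b∉ v∈ v≢a with ψ 𝐱 ∈? f | ψ 𝐲 ∈? f | ψ 𝐱′ ∈? f | ψ 𝐪′ ∈? f
    ... | yes x∈ | _ | _ | _ =
      [ at 0F , at 2F ]′ (on (axp (quad T)) f∈ a∈ x∈ v∈ v≢a)
    ... | no _ | yes y∈ | _ | _ =
      [ at 1F , at 3F ]′ (on (ayq (quad T)) f∈ a∈ y∈ v∈ v≢a)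
    ... | no _ | no _ | yes x∈ | _ =
      [ at 4F , at 6F ]′ (on (axp (quad′ T)) f∈ a∈ x∈ v∈ v≢a)
    ... | no _ | no _ | no _ | yes q∈ =
      [ at 7F , at 5F ]′ (on (flip (ayq (quad′ T))) f∈ a∈ q∈ v∈ v≢a)
    ... | no x∉ | no y∉ | no x′∉ | no q′∉ =
      ⊥-elim (crown crown-free K f∈ a∈ (bxq (quad′ T)) (cxy (quad T)) (b∉ ∷ x′∉ ∷ q′∉ ∷ x∉ ∷ y∉ ∷ [])
        (off T (bxq (quad′ T)) ∷ off T (bxq (quad′ T)) ∷ []))

    b-neighbour : f ∈ˡ E → ψ 𝐛 ∈ f → ψ 𝐚 ∉ f → v ∈ f → v ≢ ψ 𝐛 → v ∈ˡ points ψ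
    b-neighbour {f} f∈ b∈ a∉ v∈ v≢b with ψ 𝐱 ∈? f | ψ 𝐲 ∈? f | ψ 𝐱′ ∈? f | ψ 𝐩′ ∈? f
    ... | yes x∈ | _ | _ | _ =
      [ at 0F , at 3F ]′ (on (bxq (quad T)) f∈ b∈ x∈ v∈ v≢b)
    ... | no _ | yes y∈ | _ | _ =
      [ at 1F , at 2F ]′ (on (byp (quad T)) f∈ b∈ y∈ v∈ v≢b)
    ... | no _ | no _ | yes x∈ | _ =
      [ at 4F , at 7F ]′ (on (bxq (quad′ T)) f∈ b∈ x∈ v∈ v≢b)
    ... | no _ | no _ | no _ | yes p∈ =
      [ at 6F , at 5F ]′ (on (flip (byp (quad′ T))) f∈ b∈ p∈ v∈ v≢b)
    ... | no x∉ | no y∉ | no x′∉ | no p′∉ =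
      ⊥-elim (crown crown-free (swap K) f∈ b∈ (axp (quad′ T)) (cxy (quad T)) (a∉ ∷ x′∉ ∷ p′∉ ∷ x∉ ∷ y∉ ∷ [])
        (off T (axp (quad′ T)) ∷ off T (axp (quad′ T)) ∷ []))

    -- `quad-side` supplies an a-edge through the same `v`, which reduces the claim to
    -- `a-neighbour`.
    c-neighbour : f ∈ˡ E → ψ 𝐜 ∈ f → ψ 𝐚 ∉ f → v ∈ f → v ≢ ψ 𝐜 → v ∈ˡ points ψ
    c-neighbour f∈ c∈ a∉ v∈ v≢c
      with w , C , refl ← edge-through₂ f∈ c∈ v∈ (v≢c ∘ sym)
      with p , A , _ ← quad-side C a∉
      = a-neighbour (∈E A) (x∈ A)
          (exclude (∈E A) K (x∈ A) (other-edge (∈E A) (∈E C) (x≢y C ∘ sym) (y∈ A) (y∈ C) (x∈ C) (x∈ A) a∉))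
          (y∈ A) (x≢y A ∘ sym)

    neighbour-degree : Line (ψ 𝐜) (ψ 𝐩) (ψ 𝐪) → f ∈ˡ E → f ≢ set K → u ∈ set K → u ∈ f → v ∈ f → v ≢ u → deg v ≤ 3
    neighbour-degree {f} {u} {v} cpq f∈ f≢K u∈K u∈ v∈ v≢u = degree≤3 T cpq (case (onLine K u∈K))
      where
      case : u ≡ ψ 𝐚 ⊎ u ≡ ψ 𝐛 ⊎ u ≡ ψ 𝐜 → v ∈ˡ points ψ
      case (inj₁ refl) = a-neighbour f∈ u∈ (λ b∈ → f≢K (sym (line-unique K f∈ u∈ b∈))) v∈ v≢u
      case (inj₂ (inj₁ refl)) = b-neighbour f∈ u∈ (λ a∈ → f≢K (sym (line-unique K f∈ a∈ u∈))) v∈ v≢u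
      case (inj₂ (inj₂ refl)) = c-neighbour f∈ u∈ (λ a∈ → f≢K (sym (line-unique (flip K) f∈ a∈ u∈))) v∈ v≢u

  -- By `full-quad` one of the quads has both its c-edges; `swap-′` puts that quad first.
  heavy-neighbour : (K : Line a b c) → 5 ≤ deg a → 5 ≤ deg b → 4 ≤ deg c →
    f ∈ˡ E → f ≢ set K → u ∈ set K → u ∈ f → v ∈ f → v ≢ u → deg v ≤ 3
  heavy-neighbour K da db dc with vs , T ← HeavyEdge.two-quads K da db dc
    with full-quad T K da db dc
  ... | inj₁ cpq = neighbour-degree T K da db dc cpq
  ... | inj₂ cpq = neighbour-degree (swap-′ T) K da db dc cpq

-- Discharging and the final count.

module Discharging {n : ℕ} (G : Linear3Graph n) (crown-free : CrownFree G) where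

  open import Data.Nat using (_≤_; _*_; _<?_)
  open import Algebra.Properties.CommutativeSemigroup ℕ.+-commutativeSemigroup
    using (xy∙z≈xz∙y; xy∙z≈zx∙y; xy∙z≈yx∙z; xy∙z≈yz∙x; xy∙z≈zy∙x)

  open Incidence G
  open Line
  open Crownless G crown-free

  private
    E = edges G
    deg = degree G
    variable
      a b c u v x y z : Fin n
      e f : Subset n

  basic : Fin n → ℕ
  basic = share ∘ deg

  Heavy : Subset n → Set
  Heavy e = sum (map basic (members e)) < 20

  record HeavyShape (e : Subset n) : Set where
    constructor heavy-shape
    field
      {va vb vc} : Fin n
      line  : Line va vb vc
      set≡  : set line ≡ e
      5≤da  : 5 ≤ deg va
      5≤db  : 5 ≤ deg vb
      4≤dc  : 4 ≤ deg vc
      da≤5  : deg va ≤ 5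
      db≤5  : deg vb ≤ 5
      dc≤5  : deg vc ≤ 5

  -- Anything else feeds the edge 20: `deg c` at most 1 gives 20 alone, and `deg b` at most 3 gives
  -- 10 + 10. Then `no-high-edge` bounds `deg a` by 5, after which `deg b` at most 4 gives 6 + 7 + 7
  -- and `deg c` at most 3 gives 6 + 6 + 10.
  sorted-shape : (K : Line a b c) → deg b ≤ deg a → deg c ≤ deg b →
    basic a + basic b + basic c < 20 → HeavyShape (set K)
  sorted-shape {a} {b} {c} K b≤a c≤b light = record
    { line = K ; set≡ = refl ; 5≤da = ℕ.≤-trans 5≤db b≤a ; 5≤db = 5≤db ; 4≤dc = 4≤dc
    ; da≤5 = da≤5 ; db≤5 = ℕ.≤-trans b≤a da≤5 ; dc≤5 = ℕ.≤-trans c≤b (ℕ.≤-trans b≤a da≤5) }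
    where
    absurd : ∀ {i j k} → deg a ≤ i → deg b ≤ j → deg c ≤ k →
      20 ≤ share i + share j + share k → ⊥
    absurd a≤ b≤ c≤ 20≤ = ℕ.<⇒≱ light (ℕ.≤-trans 20≤
      (ℕ.+-mono-≤ (ℕ.+-mono-≤ (share-antitone a≤) (share-antitone b≤)) (share-antitone c≤)))
    2≤dc : 2 ≤ deg c
    2≤dc = ℕ.≮⇒≥ λ c<2 → absurd ℕ.≤-refl ℕ.≤-refl (s≤s⁻¹ c<2) (ℕ.m≤n+m 20 _)
    4≤db : 4 ≤ deg b
    4≤db = ℕ.≮⇒≥ λ b<4 → absurd ℕ.≤-refl (s≤s⁻¹ b<4) (ℕ.≤-trans c≤b (s≤s⁻¹ b<4))
      (subst (20 ≤_) (sym (ℕ.+-assoc (basic a) 10 10)) (ℕ.m≤n+m 20 (basic a)))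
    da≤5 : deg a ≤ 5
    da≤5 = ℕ.≮⇒≥ λ 5<a → no-high-edge K 5<a 4≤db 2≤dc
    5≤db : 5 ≤ deg b
    5≤db = ℕ.≮⇒≥ λ b<5 → absurd da≤5 (s≤s⁻¹ b<5) (ℕ.≤-trans c≤b (s≤s⁻¹ b<5)) (from-yes (20 ≤? 20))
    4≤dc : 4 ≤ deg c
    4≤dc = ℕ.≮⇒≥ λ c<4 → absurd da≤5 (ℕ.≤-trans b≤a da≤5) (s≤s⁻¹ c<4) (from-yes (20 ≤? 22))

  line-shape : (K : Line x y z) → basic x + basic y + basic z < 20 → HeavyShape (set K)
  line-shape {x} {y} {z} K light
    with ℕ.≤-total (deg y) (deg x) | ℕ.≤-total (deg z) (deg y) | ℕ.≤-total (deg z) (deg x)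
  ... | inj₁ y≤x | inj₁ z≤y | _        = sorted-shape K y≤x z≤y light
  ... | inj₁ y≤x | inj₂ y≤z | inj₁ z≤x = sorted-shape (flip K) z≤x y≤z
        (subst (_< 20) (xy∙z≈xz∙y (basic x) (basic y) (basic z)) light)
  ... | inj₁ y≤x | inj₂ y≤z | inj₂ x≤z = sorted-shape (rotate (rotate K)) x≤z y≤x
        (subst (_< 20) (xy∙z≈zx∙y (basic x) (basic y) (basic z)) light)
  ... | inj₂ x≤y | inj₁ z≤y | inj₁ z≤x = sorted-shape (swap K) x≤y z≤x
        (subst (_< 20) (xy∙z≈yx∙z (basic x) (basic y) (basic z)) light)
  ... | inj₂ x≤y | inj₁ z≤y | inj₂ x≤z = sorted-shape (rotate K) z≤y x≤z
        (subst (_< 20) (xy∙z≈yz∙x (basic x) (basic y) (basic z)) light)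
  ... | inj₂ x≤y | inj₂ y≤z | _        = sorted-shape (swap (rotate K)) y≤z x≤y
        (subst (_< 20) (xy∙z≈zy∙x (basic x) (basic y) (basic z)) light)

  sum-members : ∀ (g : Fin n → ℕ) → members e ≡ x ∷ y ∷ z ∷ [] →
    sum (map g (members e)) ≡ g x + g y + g z
  sum-members {x = x} {y} {z} g eq rewrite eq | ℕ.+-identityʳ (g z) = sym (ℕ.+-assoc (g x) _ _)

  edge-shape : e ∈ˡ E → Heavy e → HeavyShape e
  edge-shape e∈ light with x , y , z , eq , K , refl ← edge-vertices e∈ =
    line-shape K (subst (_< 20) (sum-members basic eq) light)

  heavy-degree : e ∈ˡ E → Heavy e → v ∈ e → 4 ≤ deg v × deg v ≤ 5
  heavy-degree e∈ h v∈ with edge-shape e∈ h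
  ... | heavy-shape K refl 5≤a 5≤b 4≤c a≤5 b≤5 c≤5 with onLine K v∈
  ...   | inj₁ refl        = ℕ.≤-trans (ℕ.n≤1+n 4) 5≤a , a≤5
  ...   | inj₂ (inj₁ refl) = ℕ.≤-trans (ℕ.n≤1+n 4) 5≤b , b≤5
  ...   | inj₂ (inj₂ refl) = 4≤c , c≤5

  degree-near-heavy : e ∈ˡ E → f ∈ˡ E → Heavy f → e ≢ f → u ∈ f → u ∈ e → v ∈ e → v ≢ u → deg v ≤ 3
  degree-near-heavy e∈ f∈ h e≢f uf ue ve v≢u with edge-shape f∈ h
  ... | heavy-shape K refl 5≤a 5≤b 4≤c _ _ _ = heavy-neighbour K 5≤a 5≤b 4≤c e∈ e≢f uf ue ve v≢u

  heavy? : Decidable Heavy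
  heavy? e = sum (map basic (members e)) <? 20

  Central : Fin n → Set
  Central v = Any (λ f → v ∈ f × Heavy f) E

  central? : Decidable Central
  central? v = any? (λ f → (v ∈? f) ×-dec heavy? f) E

  -- Central vertices can be excused from their non-heavy edges: the two other vertices of such an
  -- edge pay 10 each.
  weight : Fin n → Subset n → ℕ
  weight v e = if does (heavy? e) then 10 else if does (central? v) then 0 else basic v

  weight-heavy : Heavy e → weight v e ≡ 10
  weight-heavy {e} h rewrite dec-true (heavy? e) h = refl

  weight-central : ¬ Heavy e → Central v → weight v e ≡ 0
  weight-central {e} {v} ¬h cv rewrite dec-false (heavy? e) ¬h | dec-true (central? v) cv = refl

  weight-basic : ¬ Heavy e → ¬ Central v → weight v e ≡ basic v
  weight-basic {e} {v} ¬h ¬cv rewrite dec-false (heavy? e) ¬h | dec-false (central? v) ¬cv = refl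

  central-degree : Central v → 4 ≤ deg v × deg v ≤ 5
  central-degree cv with f , f∈ , v∈ , h ← find cv = heavy-degree f∈ h v∈

  -- By `degree-near-heavy` the degree of `v` is at most 3. Central vertices have degree at least 4,
  -- so `v` is not central and pays its basic share.
  weight-near-central : e ∈ˡ E → ¬ Heavy e → Central u → u ∈ e → v ∈ e → v ≢ u → 10 ≤ weight v e
  weight-near-central {v = v} e∈ ¬h cu u∈ v∈ v≢u with f , f∈ , uf , h ← find cu =
    subst (10 ≤_) (sym (weight-basic ¬h λ cv → ℕ.<⇒≱ (proj₁ (central-degree cv)) dv≤3)) (share-antitone dv≤3)
    where
    dv≤3 : deg v ≤ 3
    dv≤3 = degree-near-heavy e∈ f∈ h (λ { refl → ¬h h }) uf u∈ v∈ v≢u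

  -- A heavy edge gets 10 from each vertex; a non-heavy edge with a central vertex gets at least 10
  -- from each of the other two; any other edge gets its basic sum, which is at least 20 as it is
  -- not heavy.
  edge-weight : e ∈ˡ E → 20 ≤ sum (map (λ v → weight v e) (members e))
  edge-weight e∈ with x , y , z , eq , K , refl ← edge-vertices e∈ =
    subst (20 ≤_) (sym (sum-members (λ v → weight v (set K)) eq))
      (bound (heavy? (set K)) (central? x) (central? y) (central? z))
    where
    wx = weight x (set K)
    wy = weight y (set K)
    wz = weight z (set K)
    near : ¬ Heavy (set K) → Central u → u ∈ set K → v ∈ set K → v ≢ u → 10 ≤ weight v (set K)
    near = weight-near-central (∈E K)
    bound : Dec (Heavy (set K)) → Dec (Central x) → Dec (Central y) → Dec (Central z) → 20 ≤ wx + wy + wz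
    bound (yes h) _ _ _ = ℕ.≤-trans (from-yes (20 ≤? 30)) (ℕ.≤-reflexive
      (sym (cong₂ _+_ (cong₂ _+_ (weight-heavy {v = x} h) (weight-heavy {v = y} h)) (weight-heavy {v = z} h))))
    bound (no ¬h) (yes cx) _ _ = ℕ.+-mono-≤ (ℕ.≤-trans (near ¬h cx (x∈ K) (y∈ K) (x≢y K ∘ sym)) (ℕ.m≤n+m wy wx))
                               (near ¬h cx (x∈ K) (z∈ K) (x≢z K ∘ sym))
    bound (no ¬h) _ (yes cy) _ = ℕ.+-mono-≤ (ℕ.≤-trans (near ¬h cy (y∈ K) (x∈ K) (x≢y K)) (ℕ.m≤m+n wx wy))
                               (near ¬h cy (y∈ K) (z∈ K) (y≢z K ∘ sym))
    bound (no ¬h) _ _ (yes cz) = ℕ.m≤n⇒m≤n+o wz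
                               (ℕ.+-mono-≤ (near ¬h cz (z∈ K) (x∈ K) (x≢z K)) (near ¬h cz (z∈ K) (y∈ K) (y≢z K)))
    bound (no ¬h) (no ¬cx) (no ¬cy) (no ¬cz) = subst (20 ≤_)
      (trans (sum-members basic eq) (sym (cong₂ _+_ (cong₂ _+_ (weight-basic ¬h ¬cx) (weight-basic ¬h ¬cy)) (weight-basic ¬h ¬cz))))
      (ℕ.≮⇒≥ ¬h)

  -- Otherwise the other vertices of `e` would have degree at most 3 as neighbours of the heavy `f`,
  -- yet at least 4 as vertices of the heavy `e`.
  at-most-one-heavy : e ∈ˡ E → f ∈ˡ E → v ∈ e → v ∈ f → Heavy e → Heavy f → e ≡ f
  at-most-one-heavy {e} {f} e∈ f∈ ve vf he hf with ≡-dec Bool._≟_ e f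
  ... | yes eq = eq
  ... | no e≢f with y , z , L , refl ← edge-through e∈ ve =
    contradiction (degree-near-heavy e∈ f∈ hf e≢f vf ve (y∈ L) (x≢y L ∘ sym))
      (ℕ.<⇒≱ (proj₁ (heavy-degree e∈ he (y∈ L))))

  star : Fin n → List (Subset n)
  star v = filter (v ∈?_) E

  ∈-star : e ∈ˡ star v → e ∈ˡ E × v ∈ e
  ∈-star = ∈-filter⁻ (_ ∈?_)

  vertex-weight-high : 6 ≤ deg v → sum (map (weight v) (star v)) ≤ 0
  vertex-weight-high {v} 6≤d = subst (sum (map (weight v) (star v)) ≤_) (ℕ.*-zeroʳ (deg v))
    (sum-upper (weight v) λ e∈ → ℕ.≤-reflexive (weightless e∈))
    where
    ¬central : ¬ Central v
    ¬central cv = ℕ.<⇒≱ 6≤d (proj₂ (central-degree cv))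
    weightless : e ∈ˡ star v → weight v e ≡ 0
    weightless e∈ with e∈E , v∈ ← ∈-star e∈ =
      trans (weight-basic (λ h → ¬central (lose e∈E (v∈ , h))) ¬central)
        (ℕ.n≤0⇒n≡0 (share-antitone 6≤d))

  -- A central vertex pays only its unique heavy edge; any other vertex pays `deg v` equal shares.
  vertex-weight : ∀ v → sum (map (weight v) (star v)) ≤ 30
  vertex-weight v = bound (central? v)
    where
    weight≤10 : Central v → Dec (Heavy e) → weight v e ≤ 10
    weight≤10 cv (yes h) = ℕ.≤-reflexive (weight-heavy {v = v} h)
    weight≤10 cv (no ¬h) = ℕ.≤-trans (ℕ.≤-reflexive (weight-central ¬h cv)) z≤n
    bound : Dec (Central v) → sum (map (weight v) (star v)) ≤ 30
    bound (yes cv) = ℕ.≤-trans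
      (sum-support-≤1 heavy? (weight v) (filter⁺ (v ∈?_) (unique G))
        (λ e∈ f∈ → at-most-one-heavy (proj₁ (∈-star e∈)) (proj₁ (∈-star f∈)) (proj₂ (∈-star e∈)) (proj₂ (∈-star f∈)))
        (λ {e} _ → weight≤10 cv (heavy? e)) (λ _ ¬h → ℕ.≤-reflexive (weight-central ¬h cv)))
      (from-yes (10 ≤? 30))
    bound (no ¬cv) = ℕ.≤-trans
      (sum-upper (weight v) λ e∈ → ℕ.≤-reflexive (weight-basic
        (λ h → ¬cv (lose (proj₁ (∈-star e∈)) (proj₂ (∈-star e∈) , h))) ¬cv))
      (*-share≤30 (deg v))

  size-bound : size G * 2 + #degree≥ G 6 * 3 ≤ n * 3
  -- The factor 10 turns 2 and 3 into the 20 an edge needs and the 30 a vertex owns.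
  size-bound = ℕ.*-cancelʳ-≤ _ _ 10 (begin
    (size G * 2 + #degree≥ G 6 * 3) * 10     ≡⟨ ℕ.*-distribʳ-+ 10 (size G * 2) (#degree≥ G 6 * 3) ⟩
    size G * 2 * 10 + #degree≥ G 6 * 3 * 10  ≡⟨ cong₂ _+_ (ℕ.*-assoc (size G) 2 10) (ℕ.*-assoc (#degree≥ G 6) 3 10) ⟩
    size G * 20 + #degree≥ G 6 * 30
      ≤⟨ ℕ.+-monoˡ-≤ _ (sum-lower (λ e → sum (map (λ v → weight v e) (members e))) edge-weight) ⟩
    sum (map (λ e → sum (map (λ v → weight v e) (members e))) E) + #degree≥ G 6 * 30
      ≡⟨ cong (_+ #degree≥ G 6 * 30) (double-count _∈?_ weight (allFin n) E) ⟩
    sum (map (λ v → sum (map (weight v) (star v))) (allFin n)) + #degree≥ G 6 * 30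
      ≤⟨ sum-upper-filter (λ v → 6 ≤? deg v) (λ v → sum (map (weight v) (star v))) (allFin n)
           vertex-weight vertex-weight-high ⟩
    length (allFin n) * 30                   ≡⟨ cong (_* 30) (length-tabulate {n = n} id) ⟩
    n * 30                                   ≡⟨ ℕ.*-assoc n 3 10 ⟨
    n * 3 * 10                               ∎)
    where open ℕ.≤-Reasoning

-- Passage to the rational inequality.

open import Data.Integer using (+_; _-_; _*_)
open import Data.Rational.Unnormalised using (_/_; _≤_; *≤*)

theorem1p1 : ∀ (n : ℕ) (G : Linear3Graph n) → CrownFree G →
    (+ size G) / 1 ≤ (+ 3 * (+ n - + #degree≥ G 6)) / 2
theorem1p1 n G crown-free = *≤* (begin
  + m * + 2                ≡⟨ ℤ.pos-* m 2 ⟨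
  + (m ℕ.* 2)              ≤⟨ ℤ.+≤+ bound ⟩
  + (3 ℕ.* (n ℕ.∸ s))      ≡⟨ ℤ.pos-* 3 (n ℕ.∸ s) ⟩
  + 3 * + (n ℕ.∸ s)        ≡⟨ cong (+ 3 *_) (ℤ.⊖-≥ s≤n) ⟨
  + 3 * (n ℤ.⊖ s)          ≡⟨ cong (+ 3 *_) (ℤ.[+m]-[+n]≡m⊖n n s) ⟨
  + 3 * (+ n - + s)        ≡⟨ ℤ.*-identityʳ _ ⟨
  + 3 * (+ n - + s) * + 1  ∎)
  where
  open ℤ.≤-Reasoning
  m = size G
  s = #degree≥ G 6
  total : m ℕ.* 2 + s ℕ.* 3 ℕ.≤ n ℕ.* 3
  total = Discharging.size-bound G crown-free
  -- Ensures that `n ∸ s` agrees with the integer difference in the statement.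
  s≤n : s ℕ.≤ n
  s≤n = ℕ.*-cancelʳ-≤ s n 3 (ℕ.≤-trans (ℕ.m≤n+m (s ℕ.* 3) (m ℕ.* 2)) total)
  bound : m ℕ.* 2 ℕ.≤ 3 ℕ.* (n ℕ.∸ s)
  bound = subst (m ℕ.* 2 ℕ.≤_) (trans (sym (ℕ.*-distribʳ-∸ 3 n s)) (ℕ.*-comm (n ℕ.∸ s) 3))
    (ℕ.m+n≤o⇒m≤o∸n (m ℕ.* 2) total)
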